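{- Let $T$ be a string of length $n \geq 3$ with $\mathsf{e}(T) \geq 3$, and let $a$ be any character. Then $\mathsf{e}(aT) - \mathsf{e}(T) \leq \mathsf{e}(T) - 1$. Equivalently, for $n \geq 3$ and $\mathsf{e} \geq 3$, the worst-case additive sensitivity of the CDAWG size under left-end insertion is at most $\mathsf{e}-1$.
   Context: Strings are finite sequences of characters from an alphabet $\Sigma$; $\varepsilon$ is the empty string, $|T|$ is the length of $T$, $T[i]$ its $i$-th character and $T[i..j]=T[i]\cdots T[j]$. For a string $T$, $\mathrm{Substr}(T)$, $\mathrm{Prefix}(T)$, $\mathrm{Suffix}(T)$ denote its sets of substrings, prefixes and suffixes (all containing $\varepsilon$). A substring $u$ of $T$ is left-maximal in $T$ if $u$ is a prefix of $T$ or there are distinct characters $c \neq d$ with $cu, du \in \mathrm{Substr}(T)$; it is right-maximal in $T$ if $u$ is a suffix of $T$ or there are distinct characters $c\neq d$ with $uc, ud \in \mathrm{Substr}(T)$. $\mathsf{M}(T)$ is the set of substrings of $T$ that are both left- and right-maximal (it contains $\varepsilon$ and $T$). The compact directed acyclic word graph $\mathrm{CDAWG}(T)$ has exactly one node for each element of $\mathsf{M}(T)$, and the outgoing edges of the node $x \in \mathsf{M}(T)$ are in bijection with the characters $c$ such that $xc \in \mathrm{Substr}(T)$. For any string $w$, let $d_T(w)$ be the number of distinct characters $c$ with $wc \in \mathrm{Substr}(T)$ (for $x\in\mathsf{M}(T)$ this is the out-degree of $x$ in $\mathrm{CDAWG}(T)$). The size of the CDAWG is its number of edges, $\mathsf{e}(T)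 = \sum_{x \in \mathsf{M}(T)} d_T(x)$. -}

module Defs where

open import Data.Bool using (Bool; true; false; _∨_)
open import Data.Nat using (ℕ; _≤ᵇ_)
open import Data.List using (List; []; _∷_; _++_; [_]; inits; tails; concatMap; filter; deduplicate; length; map)
open import Data.Nat.ListAction using (sum)
open import Data.List.Relation.Binary.Infix.Heterogeneous using (Infix)
open import Data.List.Relation.Binary.Infix.Heterogeneous.Properties using (infix?)
open import Data.List.Relation.Binary.Prefix.Heterogeneous using (Prefix)
open import Data.List.Relation.Binary.Prefix.Heterogeneous.Properties using (prefix?)
open import Data.List.Relation.Binary.Suffix.Heterogeneous using (Suffix)
open import Data.List.Relation.Binary.Suffix.Heterogeneous.Properties using (suffix?)
open import Data.List.Properties using (≡-dec)
open import Relation.Binary.PropositionalEquality using (_≡_)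
open import Relation.Binary.Definitions using (DecidableEquality)
open import Relation.Nullary.Decidable using (does)

module CDAWG {A : Set} (_≟_ : DecidableEquality A) where

  _≟ₛ_ : DecidableEquality (List A)
  _≟ₛ_ = ≡-dec _≟_

  Substr : List A → List A → Set
  Substr u T = Infix _≡_ u T

  substr? : (u T : List A) → Bool
  substr? u T = does (infix? _≟_ u T)

  isPrefix? : (u T : List A) → Bool
  isPrefix? u T = does (prefix? _≟_ u T)

  isSuffix? : (u T : List A) → Bool
  isSuffix? u T = does (suffix? _≟_ u T)

  -- the distinct characters occurring in T (every c with wc or cw a
  -- substring of T occurs in T, so these are the only candidates)
  chars : List A → List A
  chars T = deduplicate _≟_ T

  substrings : List A → List (List A)
  substrings T = deduplicate _≟ₛ_ (concatMap inits (tails T))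

  d : List A → List A → ℕ
  d T w = length (filter (λ c → substr? (w ++ [ c ]) T Data.Bool.≟ true) (chars T))
    where import Data.Bool

  dL : List A → List A → ℕ
  dL T w = length (filter (λ c → substr? (c ∷ w) T Data.Bool.≟ true) (chars T))
    where import Data.Bool

  leftMaximal? : List A → List A → Bool
  leftMaximal? T u = isPrefix? u T ∨ (2 ≤ᵇ dL T u)

  rightMaximal? : List A → List A → Bool
  rightMaximal? T u = isSuffix? u T ∨ (2 ≤ᵇ d T u)

  -- M(T): substrings both left- and right-maximal (the CDAWG nodes)
  M : List A → List (List A)
  M T = filter (λ u → (leftMaximal? T u Data.Bool.∧ rightMaximal? T u) Data.Bool.≟ true) (substrings T)
    where import Data.Bool

  -- e(T) = Σ_{x ∈ M(T)} d_T(x), the number of CDAWG edges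
  e : List A → ℕ
  e T = sum (map (d T) (M T))

{-# OPTIONS --safe #-}
module Submission where

-- Let x₀ be the longest prefix of aT that occurs in T, followed by c₀ in aT. Prepending
-- a adds exactly one right extension (c₀, to x₀), and a node of aT that is not a node of
-- T is aT itself (of degree 0), or x₀ when x₀ is not right-maximal in T (of degree 1 in T),
-- or a "fresh" node: a prefix w of x₀ that is right- but not left-maximal in T.
-- Extending a fresh w to the left as long as the extension is forced gives a node αw of T
-- of the same degree and of length at least 2. This map is injective: if αw = α′w′ with w a
-- proper prefix of w′, then every occurrence of w would have another one to its left.
-- So e(aT) ≤ 2 e(T) + 1 (or + 2, if x₀ is not right-maximal in T) minus the degrees of the
-- nodes of T of length at most 1. These degrees suffice: T is not a power of one character
-- as soon as a fresh node exists, and if moreover x₀ is not right-maximal then its last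
-- character z has two distinct extensions in T. Without fresh nodes e(aT) ≤ e(T) + 2.

open import Defs
open import Data.Nat using (_≤_)
open import Data.List using (List; _∷_; length)
open import Data.Integer using (+_; _-_)
open import Relation.Binary.Definitions using (DecidableEquality)

import Data.Bool as Bool
import Data.Bool.Properties as Bool
import Data.Integer as ℤ
import Data.Integer.Properties as ℤ
open import Data.Bool using (true; false; _∨_; _∧_)
open import Data.Empty using (⊥)
open import Data.List using ([]; _++_; [_]; _∷ʳ_; map; filter; inits; tails; concatMap; initLast; _∷ʳ′_)
open import Data.List.Membership.Propositional using (_∈_; find; lose)
open import Data.List.Membership.Propositional.Properties
open import Data.List.Properties using (∷-injective; ++-assoc; ++-identityʳ; ++-cancelˡ; length-++; length-++-≤ˡ; length-++-≤ʳ; map-++; map-∘)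
open import Data.List.Relation.Binary.Infix.Heterogeneous using (Infix; here; there)
open import Data.List.Relation.Binary.Infix.Heterogeneous.Properties using (infix?)
open import Data.List.Relation.Binary.Permutation.Propositional using (↭-sym)
open import Data.List.Relation.Binary.Permutation.Propositional.Properties using (shift; map⁺)
open import Data.List.Relation.Binary.Pointwise using (Pointwise-≡⇒≡; ≡⇒Pointwise-≡)
open import Data.List.Relation.Binary.Prefix.Heterogeneous using (Prefix; []; _∷_)
open import Data.List.Relation.Binary.Prefix.Heterogeneous.Properties using (prefix?)
open import Data.List.Relation.Binary.Suffix.Heterogeneous using (Suffix; here; there)
open import Data.List.Relation.Binary.Suffix.Heterogeneous.Properties using (suffix?)
open import Data.List.Relation.Unary.All as All using (All; []; _∷_; all?)
open import Data.List.Relation.Unary.All.Properties using (¬All⇒Any¬)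
open import Data.List.Relation.Unary.Any using (here; there; any?)
open import Data.List.Relation.Unary.Unique.Propositional using (Unique; []; _∷_)
import Data.List.Relation.Unary.Unique.Propositional.Properties as Unique
import Data.List.Relation.Unary.Unique.DecPropositional.Properties as DecUnique
open import Data.Nat using (ℕ; zero; suc; _+_; _<_; z≤n; s≤s; _≤?_; _≤ᵇ_)
open import Data.Nat.ListAction using (sum)
open import Data.Nat.ListAction.Properties using (sum-++; sum-↭)
open import Data.Nat.Properties
open import Data.Product using (∃; ∃₂; _×_; _,_; proj₁; proj₂)
open import Data.Sum using (_⊎_; inj₁; inj₂)
open import Function using (_∘_; const)
open import Relation.Binary.PropositionalEquality using (_≡_; _≢_; refl; sym; trans; cong; subst; subst₂; module ≡-Reasoning)
open import Relation.Nullary using (¬_; Dec; yes; no; does; contradiction)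
open import Relation.Nullary.Decidable using (map′; dec-true; ¬?; _×-dec_)

-- Sums over lists without repetitions.

sum-match : ∀ {X Y : Set} {f : X → ℕ} {g : Y → ℕ} (R : X → Y → Set) →
  (∀ {x x′ y} → R x y → R x′ y → x ≡ x′) →
  ∀ {xs} → Unique xs → ∀ ys → (∀ {x} → x ∈ xs → ∃ λ y → y ∈ ys × R x y × f x ≤ g y) →
  sum (map f xs) ≤ sum (map g ys)
sum-match R inj [] ys m = z≤n
sum-match {f = f} {g} R inj {x ∷ xs} (x∉xs ∷ xs!) ys m
  with y , y∈ys , r , le ← m (here refl)
  with ys₁ , ys₂ , refl ← ∈-∃++ y∈ys = begin
    f x + sum (map f xs)           ≤⟨ +-mono-≤ le (sum-match R inj xs! (ys₁ ++ ys₂) m′) ⟩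
    g y + sum (map g (ys₁ ++ ys₂)) ≡⟨ sum-↭ (map⁺ g (↭-sym (shift y ys₁ ys₂))) ⟩
    sum (map g (ys₁ ++ y ∷ ys₂))   ∎
  where
  open ≤-Reasoning
  -- The matched occurrence of `y` has been removed from the list. A later `x′` matched to it would
  -- equal `x` by injectivity of `R`, but `x` does not recur in `xs`.
  m′ : ∀ {x′} → x′ ∈ xs → ∃ λ y′ → y′ ∈ ys₁ ++ ys₂ × R x′ y′ × f x′ ≤ g y′
  m′ x′∈xs with m (there x′∈xs)
  ... | y′ , y′∈ys , r′ , le′ with ∈-++⁻ ys₁ y′∈ys
  ...   | inj₁ y′∈ys₁         = y′ , ∈-++⁺ˡ y′∈ys₁ , r′ , le′
  ...   | inj₂ (here refl)    = contradiction (inj r r′) (All.lookup x∉xs x′∈xs)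
  ...   | inj₂ (there y′∈ys₂) = y′ , ∈-++⁺ʳ ys₁ y′∈ys₂ , r′ , le′

sum-⊆ : ∀ {X : Set} {f g : X → ℕ} {xs} → Unique xs → ∀ ys →
  (∀ {x} → x ∈ xs → x ∈ ys × f x ≤ g x) → sum (map f xs) ≤ sum (map g ys)
sum-⊆ xs! ys m = sum-match _≡_ (λ { refl refl → refl }) xs! ys
  λ x∈xs → let x∈ys , le = m x∈xs in _ , x∈ys , refl , le

length-⊆ : ∀ {X : Set} {xs ys : List X} → Unique xs → (∀ {x} → x ∈ xs → x ∈ ys) → length xs ≤ length ys
length-⊆ {xs = xs} {ys} xs! xs⊆ys = subst₂ _≤_ (sum-ones xs) (sum-ones ys)
  (sum-⊆ {f = const 1} {const 1} xs! ys λ x∈xs → xs⊆ys x∈xs , ≤-refl)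
  where
  sum-ones : ∀ {X : Set} (xs : List X) → sum (map (const 1) xs) ≡ length xs
  sum-ones []       = refl
  sum-ones (_ ∷ xs) = cong suc (sum-ones xs)

-- `x₀` occurs at most once in `xs`, so its excess of 1 is paid at most once.
sum-except-one : ∀ {X : Set} → DecidableEquality X → {f g : X → ℕ} (x₀ : X) →
  f x₀ ≤ suc (g x₀) → ∀ {xs} → Unique xs → (∀ {x} → x ∈ xs → x ≢ x₀ → f x ≤ g x) →
  sum (map f xs) ≤ suc (sum (map g xs))
sum-except-one _≟_ x₀ fx₀≤ [] f≤g = z≤n
sum-except-one _≟_ {f} {g} x₀ fx₀≤ {x ∷ xs} (x∉xs ∷ xs!) f≤g with x ≟ x₀
... | yes refl = +-mono-≤ fx₀≤ (sum-⊆ xs! xs λ y∈xs →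
                   y∈xs , f≤g (there y∈xs) λ { refl → All.lookup x∉xs y∈xs refl })
... | no x≢x₀  = begin
  f x + sum (map f xs)       ≤⟨ +-mono-≤ (f≤g (here refl) x≢x₀) (sum-except-one _≟_ x₀ fx₀≤ xs! (f≤g ∘ there)) ⟩
  g x + suc (sum (map g xs)) ≡⟨ +-suc (g x) _ ⟩
  suc (g x + sum (map g xs)) ∎
  where open ≤-Reasoning

unique-pair : ∀ {X : Set} {x y : X} → x ≢ y → Unique (x ∷ y ∷ [])
unique-pair x≢y = (x≢y ∷ []) ∷ [] ∷ []

two-elements : ∀ {X : Set} {xs : List X} → Unique xs → 2 ≤ length xs → ∃₂ λ x y → x ≢ y × x ∈ xs × y ∈ xs
two-elements ((x≢y ∷ _) ∷ _) _ = _ , _ , x≢y , here refl , there (here refl)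
two-elements (_ ∷ []) (s≤s ())

-- Reading off Boolean tests.

2≤ᵇ⇒2≤ : ∀ n → (2 ≤ᵇ n) ≡ true → 2 ≤ n
2≤ᵇ⇒2≤ (suc (suc n)) _ = s≤s (s≤s z≤n)

2≤⇒2≤ᵇ : ∀ {n} → 2 ≤ n → (2 ≤ᵇ n) ≡ true
2≤⇒2≤ᵇ (s≤s (s≤s _)) = refl

does-true : ∀ {P : Set} (P? : Dec P) → does P? ≡ true → P
does-true (yes p) _ = p

∨-true : ∀ x {y} → x ∨ y ≡ true → x ≡ true ⊎ y ≡ true
∨-true true  _  = inj₁ refl
∨-true false eq = inj₂ eq

∧-true : ∀ x {y} → x ∧ y ≡ true → x ≡ true × y ≡ true
∧-true true eq = refl , eq

-- Prefixes, suffixes and substrings as concatenation equations.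

module _ {A : Set} where

  IsPrefix IsSuffix IsSubstr : List A → List A → Set
  IsPrefix u T = ∃ λ q → T ≡ u ++ q
  IsSuffix u T = ∃ λ p → T ≡ p ++ u
  IsSubstr u T = ∃₂ λ p q → T ≡ p ++ u ++ q

  fromPrefix : ∀ {u T} → Prefix _≡_ u T → IsPrefix u T
  fromPrefix []           = _ , refl
  fromPrefix (refl ∷ pre) = let q , eq = fromPrefix pre in q , cong (_ ∷_) eq

  toPrefix : ∀ (u q : List A) → Prefix _≡_ u (u ++ q)
  toPrefix []      q = []
  toPrefix (c ∷ u) q = refl ∷ toPrefix u q

  fromSuffix : ∀ {u T} → Suffix _≡_ u T → IsSuffix u T
  fromSuffix (here u≋T)  = [] , sym (Pointwise-≡⇒≡ u≋T)
  fromSuffix (there suf) = let p , eq = fromSuffix suf in _ ∷ p , cong (_ ∷_) eq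

  toSuffix : ∀ (p u : List A) → Suffix _≡_ u (p ++ u)
  toSuffix []      u = here (≡⇒Pointwise-≡ refl)
  toSuffix (c ∷ p) u = there (toSuffix p u)

  fromInfix : ∀ {u T} → Infix _≡_ u T → IsSubstr u T
  fromInfix (here pre)  = let q , eq = fromPrefix pre in [] , q , eq
  fromInfix (there inf) = let p , q , eq = fromInfix inf in _ ∷ p , q , cong (_ ∷_) eq

  toInfix : ∀ (p u q : List A) → Infix _≡_ u (p ++ u ++ q)
  toInfix []      u q = here (toPrefix u q)
  toInfix (c ∷ p) u q = there (toInfix p u q)

  prefix⇒substr : ∀ {u T} → IsPrefix u T → IsSubstr u T
  prefix⇒substr (q , eq) = [] , q , eq

  substr-prefix : ∀ u {v T : List A} → IsSubstr (u ++ v) T → IsSubstr u T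
  substr-prefix u (p , q , eq) = p , _ , trans eq (cong (p ++_) (++-assoc u _ q))

  substr-suffix : ∀ u {v T : List A} → IsSubstr (u ++ v) T → IsSubstr v T
  substr-suffix u {v} (p , q , eq) =
    p ++ u , q , trans eq (trans (cong (p ++_) (++-assoc u v q)) (sym (++-assoc p u (v ++ q))))

  substr-length : ∀ {u T : List A} → IsSubstr u T → length u ≤ length T
  substr-length {u} (p , q , refl) = ≤-trans (length-++-≤ˡ u) (length-++-≤ʳ (u ++ q) {p})

  substr-∷ : ∀ {u a T} → IsSubstr u (a ∷ T) → IsPrefix u (a ∷ T) ⊎ IsSubstr u T
  substr-∷ ([] , q , eq)    = inj₁ (q , eq)
  substr-∷ (b ∷ p , q , eq) = inj₂ (p , q , proj₂ (∷-injective eq))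

  ∈⇒substr : ∀ {c T} → c ∈ T → IsSubstr [ c ] T
  ∈⇒substr c∈T = ∈-∃++ c∈T

  substr⇒∈ : ∀ {c T} → IsSubstr [ c ] T → c ∈ T
  substr⇒∈ (p , q , refl) = ∈-++⁺ʳ p (here refl)

  -- Two prefixes of one string are comparable. The strict case keeps the character `e` that follows
  -- `v`; it heads `r` and can thus be identified.
  compare-prefixes : ∀ u v {q r : List A} → u ++ q ≡ v ++ r →
    (∃ λ s → v ≡ u ++ s) ⊎ (∃₂ λ e s → u ≡ v ++ e ∷ s × r ≡ e ∷ s ++ q)
  compare-prefixes []      v       eq = inj₁ (v , refl)
  compare-prefixes (c ∷ u) []      eq = inj₂ (c , u , refl , sym eq)
  compare-prefixes (c ∷ u) (d ∷ v) eq with ∷-injective eq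
  ... | refl , eq′ with compare-prefixes u v eq′
  ...   | inj₁ (s , refl)             = inj₁ (s , refl)
  ...   | inj₂ (e , s , refl , r≡)    = inj₂ (e , s , refl , r≡)

  prefix∈inits : ∀ (u q : List A) → u ∈ inits (u ++ q)
  prefix∈inits []      q = here refl
  prefix∈inits (c ∷ u) q with prefix∈inits u q
  ... | here refl = there (here refl)
  ... | there u∈  = there (there (∈-map⁺ (c ∷_) u∈))

  suffix∈tails : ∀ (p u : List A) → u ∈ tails (p ++ u)
  suffix∈tails []      u = here refl
  suffix∈tails (c ∷ p) u with suffix∈tails p u
  ... | here eq  = there (here eq)
  ... | there u∈ = there (there u∈)

  -- In a power of `t`, an occurrence can be shifted one place to the left; repeated shifts bring
  -- every substring to the front.
  constant-prefix : ∀ {t x : A} u {T} → All (t ≡_) (x ∷ T) → IsPrefix u T → IsPrefix u (x ∷ T)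
  constant-prefix []      all            _          = _ , refl
  constant-prefix (y ∷ u) (refl ∷ refl ∷ all) (q , refl) =
    let q′ , eq = constant-prefix u (refl ∷ all) (q , refl) in q′ , cong (_ ∷_) eq

  constant-substr : ∀ {t : A} p u {q} → All (t ≡_) (p ++ u ++ q) → IsPrefix u (p ++ u ++ q)
  constant-substr []      u all         = _ , refl
  constant-substr (x ∷ p) u (eq ∷ all) = constant-prefix u (eq ∷ all) (constant-substr p u all)

  -- Maximality and forced left contexts.

  LeftMaximal RightMaximal : List A → List A → Set
  LeftMaximal  T u = IsPrefix u T ⊎ ∃₂ λ c d → c ≢ d × IsSubstr (c ∷ u) T × IsSubstr (d ∷ u) T
  RightMaximal T u = IsSuffix u T ⊎ ∃₂ λ c d → c ≢ d × IsSubstr (u ∷ʳ c) T × IsSubstr (u ∷ʳ d) T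

  ε-leftMaximal : ∀ {T : List A} → LeftMaximal T []
  ε-leftMaximal = inj₁ (_ , refl)

  ε-rightMaximal : ∀ {T : List A} → RightMaximal T []
  ε-rightMaximal {T} = inj₁ (T , sym (++-identityʳ T))

  leftMaximal⇒substr : ∀ {T u} → LeftMaximal T u → IsSubstr u T
  leftMaximal⇒substr (inj₁ pre)                  = prefix⇒substr pre
  leftMaximal⇒substr (inj₂ (c , _ , _ , cu , _)) = substr-suffix [ c ] cu

  -- Each decomposition `p ++ w ++ q` is one occurrence of `w`. The occurrence with `p` empty counts
  -- as well, and it excludes a nonempty `α`.
  Forced : List A → List A → List A → Set
  Forced T α w = ∀ p q → T ≡ p ++ w ++ q → ∃ λ p′ → p ≡ p′ ++ α

  -- An occurrence of `w ++ r` is one of `w`, so `α` precedes it. A single character as `r`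
  -- transports right extensions; empty `r` gives `α ++ w` itself.
  forced-substr : ∀ {T α} w {r} → Forced T α w → IsSubstr (w ++ r) T → IsSubstr (α ++ w ++ r) T
  forced-substr {α = α} w {r} forced (p , q , eq) with forced p (r ++ q) (trans eq (cong (p ++_) (++-assoc w r q)))
  ... | p′ , refl = p′ , q , trans eq (trans (++-assoc p′ α _) (cong (p′ ++_) (sym (++-assoc α (w ++ r) q))))

  forced-rightMaximal : ∀ {T α} w → Forced T α w → RightMaximal T w → RightMaximal T (α ++ w)
  forced-rightMaximal {α = α} w forced (inj₁ (p , eq)) with forced p [] (trans eq (cong (p ++_) (sym (++-identityʳ w))))
  ... | p′ , refl = inj₁ (p′ , trans eq (++-assoc p′ α w))
  forced-rightMaximal {T} {α} w forced (inj₂ (c , d , c≢d , wc , wd)) =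
    inj₂ (c , d , c≢d , ext wc , ext wd)
    where
    ext : ∀ {c} → IsSubstr (w ∷ʳ c) T → IsSubstr ((α ++ w) ∷ʳ c) T
    ext {c} wc = subst (λ v → IsSubstr v T) (sym (++-assoc α w [ c ])) (forced-substr w forced wc)

  forced-∷ : ∀ {T c α w} → Forced T α w → Forced T [ c ] (α ++ w) → Forced T (c ∷ α) w
  forced-∷ {c = c} {α} {w} f g p q eq with f p q eq
  ... | p₁ , refl with g p₁ q (trans eq (trans (++-assoc p₁ α _) (cong (p₁ ++_) (sym (++-assoc α w q)))))
  ...   | p₂ , refl = p₂ , ++-assoc p₂ [ c ] α

  -- An occurrence of w inside a longer forced context lies strictly to the left of
  -- the given one, so there would be no leftmost occurrence.
  forced-rightmost : ∀ {T α α′ w e s} → Forced T α w → α ++ w ≡ α′ ++ w ++ e ∷ s → ¬ IsSubstr w T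
  forced-rightmost {T} {α} {α′} {w} {e} {s} forced eq (p₀ , q₀ , eq₀) = descend (length p₀) p₀ q₀ ≤-refl eq₀
    where
    -- As `e ∷ s` is nonempty, the new occurrence of `w`, after `p′ ++ α′`, starts before the old
    -- one, after `p′ ++ α`.
    shorter : length α′ < length α
    shorter = +-cancelʳ-≤ (length w) _ _ (begin
      suc (length α′ + length w)            ≡⟨ +-suc (length α′) _ ⟨
      length α′ + suc (length w)            ≤⟨ +-monoʳ-≤ (length α′) (≤-trans (s≤s (m≤m+n _ (length s))) (≤-reflexive (sym (+-suc (length w) _)))) ⟩
      length α′ + (length w + suc (length s)) ≡⟨ cong (λ n → length α′ + n) (length-++ w) ⟨
      length α′ + length (w ++ e ∷ s)       ≡⟨ length-++ α′ ⟨
      length (α′ ++ w ++ e ∷ s)             ≡⟨ cong length eq ⟨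
      length (α ++ w)                       ≡⟨ length-++ α ⟩
      length α + length w                   ∎)
      where open ≤-Reasoning

    descend : ∀ n p q → length p ≤ n → T ≡ p ++ w ++ q → ⊥
    descend n p q p≤n T≡ with forced p q T≡
    descend n _ q p≤n T≡ | p′ , refl = go n p≤n
      where
      lt : length (p′ ++ α′) < length (p′ ++ α)
      lt = subst₂ _<_ (sym (length-++ p′)) (sym (length-++ p′)) (+-monoʳ-< (length p′) shorter)
      T≡′ : T ≡ (p′ ++ α′) ++ w ++ e ∷ s ++ q
      T≡′ = begin
        T                                 ≡⟨ T≡ ⟩
        (p′ ++ α) ++ w ++ q               ≡⟨ ++-assoc p′ α _ ⟩
        p′ ++ α ++ w ++ q                 ≡⟨ cong (p′ ++_) (++-assoc α w q) ⟨
        p′ ++ (α ++ w) ++ q               ≡⟨ cong (λ v → p′ ++ v ++ q) eq ⟩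
        p′ ++ (α′ ++ w ++ e ∷ s) ++ q     ≡⟨ cong (p′ ++_) (++-assoc α′ _ q) ⟩
        p′ ++ α′ ++ (w ++ e ∷ s) ++ q     ≡⟨ cong (λ v → p′ ++ α′ ++ v) (++-assoc w _ q) ⟩
        p′ ++ α′ ++ w ++ e ∷ s ++ q       ≡⟨ ++-assoc p′ α′ _ ⟨
        (p′ ++ α′) ++ w ++ e ∷ s ++ q     ∎
        where open ≡-Reasoning
      go : ∀ n → length (p′ ++ α) ≤ n → ⊥
      go zero    le = contradiction (≤-trans lt le) λ ()
      go (suc n) le = descend n (p′ ++ α′) (e ∷ s ++ q) (≤-pred (≤-trans lt le)) T≡′

  -- As prefixes of `U`, `w` and `w′` are comparable. If one were a proper prefix of the other, `y`
  -- would contain the shorter one a second time, further left, against `forced-rightmost`.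
  forced-injective : ∀ {T U w w′ y α α′} → IsPrefix w U → IsPrefix w′ U → IsSubstr w T → IsSubstr w′ T →
    Forced T α w → Forced T α′ w′ → y ≡ α ++ w → y ≡ α′ ++ w′ → w ≡ w′
  forced-injective {w = w} {w′} {α = α} {α′} (q , eq) (q′ , eq′) sub sub′ forced forced′ y≡ y≡′
    with compare-prefixes w w′ (trans (sym eq) eq′)
  ... | inj₁ ([] , refl)         = sym (++-identityʳ w)
  ... | inj₁ (e ∷ s , refl)      = contradiction sub (forced-rightmost {α′ = α′} forced (trans (sym y≡) y≡′))
  ... | inj₂ (e , s , refl , _)  = contradiction sub′ (forced-rightmost {α′ = α} forced′ (trans (sym y≡′) y≡))

-- The Boolean definitions and their propositional counterparts.

module _ {A : Set} (_≟_ : DecidableEquality A) where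
  open CDAWG _≟_

  substr-dec : ∀ u T → Dec (IsSubstr u T)
  substr-dec u T = map′ fromInfix (λ { (p , q , refl) → toInfix p u q }) (infix? _≟_ u T)

  -- Their lengths are `d T w` and `dL T w` by definition, so degrees can be compared through
  -- inclusions of lists.
  rightExts leftExts : List A → List A → List A
  rightExts T w = filter (λ c → substr? (w ∷ʳ c) T Bool.≟ true) (chars T)
  leftExts  T w = filter (λ c → substr? (c ∷ w) T Bool.≟ true) (chars T)

  rightExts-! : ∀ T w → Unique (rightExts T w)
  rightExts-! T w = Unique.filter⁺ _ (DecUnique.deduplicate-! _≟_ T)

  leftExts-! : ∀ T w → Unique (leftExts T w)
  leftExts-! T w = Unique.filter⁺ _ (DecUnique.deduplicate-! _≟_ T)

  ∈-rightExts⁺ : ∀ {T w c} → IsSubstr (w ∷ʳ c) T → c ∈ rightExts T w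
  ∈-rightExts⁺ {T} {w} {c} sub@(p , q , refl) =
    ∈-filter⁺ _ (∈-deduplicate⁺ _≟_ (substr⇒∈ (substr-suffix w sub)))
      (dec-true (infix? _≟_ (w ∷ʳ c) T) (toInfix p (w ∷ʳ c) q))

  ∈-leftExts⁺ : ∀ {T w c} → IsSubstr (c ∷ w) T → c ∈ leftExts T w
  ∈-leftExts⁺ {T} {w} {c} sub@(p , q , refl) =
    ∈-filter⁺ _ (∈-deduplicate⁺ _≟_ (substr⇒∈ (substr-prefix [ c ] sub)))
      (dec-true (infix? _≟_ (c ∷ w) T) (toInfix p (c ∷ w) q))

  ∈-rightExts⁻ : ∀ {T w c} → c ∈ rightExts T w → IsSubstr (w ∷ʳ c) T
  ∈-rightExts⁻ {T} {w} {c} c∈ =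
    fromInfix (does-true (infix? _≟_ (w ∷ʳ c) T) (proj₂ (∈-filter⁻ _ {xs = chars T} c∈)))

  ∈-leftExts⁻ : ∀ {T w c} → c ∈ leftExts T w → IsSubstr (c ∷ w) T
  ∈-leftExts⁻ {T} {w} {c} c∈ =
    fromInfix (does-true (infix? _≟_ (c ∷ w) T) (proj₂ (∈-filter⁻ _ {xs = chars T} c∈)))

  d-≥ : ∀ {T w cs} → Unique cs → All (λ c → IsSubstr (w ∷ʳ c) T) cs → length cs ≤ d T w
  d-≥ cs! subs = length-⊆ cs! (∈-rightExts⁺ ∘ All.lookup subs)

  d-≤ : ∀ {T w cs} → (∀ {c} → IsSubstr (w ∷ʳ c) T → c ∈ cs) → d T w ≤ length cs
  d-≤ {T} {w} into = length-⊆ (rightExts-! T w) (into ∘ ∈-rightExts⁻)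

  leftMaximal?⇒ : ∀ T u → leftMaximal? T u ≡ true → LeftMaximal T u
  leftMaximal?⇒ T u eq with ∨-true (isPrefix? u T) eq
  ... | inj₁ pre = inj₁ (fromPrefix (does-true (prefix? _≟_ u T) pre))
  ... | inj₂ two =
    let c , d , c≢d , c∈ , d∈ = two-elements (leftExts-! T u) (2≤ᵇ⇒2≤ _ two)
    in inj₂ (c , d , c≢d , ∈-leftExts⁻ c∈ , ∈-leftExts⁻ d∈)

  rightMaximal?⇒ : ∀ T u → rightMaximal? T u ≡ true → RightMaximal T u
  rightMaximal?⇒ T u eq with ∨-true (isSuffix? u T) eq
  ... | inj₁ suf = inj₁ (fromSuffix (does-true (suffix? _≟_ u T) suf))
  ... | inj₂ two =
    let c , d , c≢d , c∈ , d∈ = two-elements (rightExts-! T u) (2≤ᵇ⇒2≤ _ two)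
    in inj₂ (c , d , c≢d , ∈-rightExts⁻ c∈ , ∈-rightExts⁻ d∈)

  ⇒leftMaximal? : ∀ T u → LeftMaximal T u → leftMaximal? T u ≡ true
  ⇒leftMaximal? T u (inj₁ (q , refl)) rewrite dec-true (prefix? _≟_ u T) (toPrefix u q) = refl
  ⇒leftMaximal? T u (inj₂ (c , d , c≢d , cu , du)) =
    trans (cong (isPrefix? u T ∨_) (2≤⇒2≤ᵇ (length-⊆ (unique-pair c≢d)
      (All.lookup (∈-leftExts⁺ cu ∷ ∈-leftExts⁺ du ∷ []))))) (Bool.∨-zeroʳ _)

  ⇒rightMaximal? : ∀ T u → RightMaximal T u → rightMaximal? T u ≡ true
  ⇒rightMaximal? T u (inj₁ (p , refl)) rewrite dec-true (suffix? _≟_ u T) (toSuffix p u) = refl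
  ⇒rightMaximal? T u (inj₂ (c , d , c≢d , uc , ud)) =
    trans (cong (isSuffix? u T ∨_) (2≤⇒2≤ᵇ (d-≥ (unique-pair c≢d) (uc ∷ ud ∷ [])))) (Bool.∨-zeroʳ _)

  leftMaximal-dec : ∀ T u → Dec (LeftMaximal T u)
  leftMaximal-dec T u = map′ (leftMaximal?⇒ T u) (⇒leftMaximal? T u) (leftMaximal? T u Bool.≟ true)

  rightMaximal-dec : ∀ T u → Dec (RightMaximal T u)
  rightMaximal-dec T u = map′ (rightMaximal?⇒ T u) (⇒rightMaximal? T u) (rightMaximal? T u Bool.≟ true)

  maximal? : ∀ T u → Dec (leftMaximal? T u ∧ rightMaximal? T u ≡ true)
  maximal? T u = (leftMaximal? T u ∧ rightMaximal? T u) Bool.≟ true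

  M-! : ∀ T → Unique (M T)
  M-! T = Unique.filter⁺ (maximal? T) (DecUnique.deduplicate-! _≟ₛ_ (concatMap inits (tails T)))

  ∈-M⁺ : ∀ {T w} → LeftMaximal T w → RightMaximal T w → w ∈ M T
  ∈-M⁺ {T} {w} lm rm = ∈-filter⁺ (maximal? T) (∈-deduplicate⁺ _≟ₛ_ w∈) maximal
    where
    maximal : leftMaximal? T w ∧ rightMaximal? T w ≡ true
    maximal rewrite ⇒leftMaximal? T w lm = ⇒rightMaximal? T w rm
    w∈ : w ∈ concatMap inits (tails T)
    w∈ with leftMaximal⇒substr lm
    ... | p , q , refl = ∈-concat⁺′ (prefix∈inits w q) (∈-map⁺ inits (suffix∈tails p (w ++ q)))

  ∈-M⁻ : ∀ {T w} → w ∈ M T → LeftMaximal T w × RightMaximal T w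
  ∈-M⁻ {T} {w} w∈ with ∧-true (leftMaximal? T w) (proj₂ (∈-filter⁻ (maximal? T) {xs = substrings T} w∈))
  ... | lm , rm = leftMaximal?⇒ T w lm , rightMaximal?⇒ T w rm

  -- Left closures.

  ¬leftMaximal⇒forced : ∀ {T v} → ¬ LeftMaximal T v → IsSubstr v T → ∃ λ c → Forced T [ c ] v
  ¬leftMaximal⇒forced {T} {v} ¬lm (p , q , eq) with initLast p
  ... | []       = contradiction (inj₁ (q , eq)) ¬lm
  -- `c` stands before the given occurrence; an occurrence at the start of `T`, or after another
  -- character, would make `v` left-maximal.
  ... | p′ ∷ʳ′ c = c , forced
    where
    forced : Forced T [ c ] v
    forced r s eq′ with initLast r
    ... | []       = contradiction (inj₁ (s , eq′)) ¬lm
    ... | r′ ∷ʳ′ e with e ≟ c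
    ...   | yes refl = r′ , refl
    ...   | no e≢c   = contradiction (inj₂ (e , c , e≢c , (r′ , s , trans eq′ (++-assoc r′ [ e ] _))
                                                       , (p′ , q , trans eq (++-assoc p′ [ c ] _)))) ¬lm

  -- Forced characters are prepended until left-maximality is reached. The fuel `n` satisfies
  -- `length T < n + length (α ++ w)` and cannot run out, since `α ++ w` still occurs in `T`.
  leftClosure : ∀ {T w} → IsSubstr w T → ∃ λ α → Forced T α w × LeftMaximal T (α ++ w)
  leftClosure {T} {w} w⊑T = go (suc (length T)) [] (s≤s (m≤m+n (length T) _)) λ p q _ → p , sym (++-identityʳ p)
    where
    go : ∀ n α → length T < n + length (α ++ w) → Forced T α w → ∃ λ α → Forced T α w × LeftMaximal T (α ++ w)
    αw⊑T : ∀ {α} → Forced T α w → IsSubstr (α ++ w) T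
    αw⊑T {α} forced = subst (λ v → IsSubstr (α ++ v) T) (++-identityʳ w)
      (forced-substr w forced (subst (λ v → IsSubstr v T) (sym (++-identityʳ w)) w⊑T))
    go zero    α lt forced = contradiction (substr-length (αw⊑T forced)) (<⇒≱ lt)
    go (suc n) α lt forced with leftMaximal-dec T (α ++ w)
    ... | yes lm = α , forced , lm
    ... | no ¬lm with ¬leftMaximal⇒forced ¬lm (αw⊑T forced)
    ...   | c , forced-c = go n (c ∷ α) (subst (length T <_) (sym (+-suc n _)) lt) (forced-∷ forced forced-c)

  -- The leftmost z is a prefix or is preceded by another character.
  square⇒leftMaximal : ∀ {T z} → IsSubstr (z ∷ z ∷ []) T → LeftMaximal T [ z ]
  square⇒leftMaximal {T} {z} zz@(p₀ , q₀ , eq₀) = go (length p₀) p₀ (z ∷ q₀) ≤-refl eq₀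
    where
    go : ∀ n p q → length p ≤ n → T ≡ p ++ z ∷ q → LeftMaximal T [ z ]
    go n p q le eq with initLast p
    ... | [] = inj₁ (q , eq)
    go zero _ q le eq | p′ ∷ʳ′ y = contradiction (subst (_≤ 0) (trans (length-++ p′) (+-comm (length p′) 1)) le) λ ()
    go (suc n) _ q le eq | p′ ∷ʳ′ y with y ≟ z
    ... | yes refl = go n p′ (z ∷ q) (≤-pred (subst (_≤ suc n) (trans (length-++ p′) (+-comm (length p′) 1)) le))
                        (trans eq (++-assoc p′ [ z ] _))
    ... | no y≢z   = inj₂ (y , z , y≢z , (p′ , q , trans eq (++-assoc p′ [ y ] _)) , zz)

  -- In a power of one character every substring is a prefix, hence left-maximal. So `T` contains a
  -- character other than its first one, and both extend the empty string.
  ¬leftMaximal⇒2≤d : ∀ {T w} → IsSubstr w T → ¬ LeftMaximal T w → 2 ≤ d T []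
  ¬leftMaximal⇒2≤d         ([] , q , eq)    ¬lm = contradiction (inj₁ (q , eq)) ¬lm
  ¬leftMaximal⇒2≤d {T} {w} (t ∷ p , q , eq) ¬lm with all? (t ≟_) T
  ... | yes all = contradiction (inj₁ (subst (IsPrefix w) (sym eq)
                    (constant-substr (t ∷ p) w (subst (All (t ≡_)) eq all)))) ¬lm
  ... | no ¬all with y , y∈T , t≢y ← find (¬All⇒Any¬ (t ≟_) T ¬all) =
    d-≥ {w = []} (unique-pair t≢y) (([] , p ++ w ++ q , eq) ∷ ∈⇒substr y∈T ∷ [])

  -- Nodes of length at least 2.

  long? : (w : List A) → Dec (2 ≤ length w)
  long? w = 2 ≤? length w

  -- The nodes that can be left closures of fresh ones; the degrees of all other nodes of `T` are
  -- saved.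
  longNodes : List A → List (List A)
  longNodes T = filter long? (M T)

  sum-longNodes : ∀ {T} ws → Unique ws → All (λ w → length w < 2 × w ∈ M T) ws →
    sum (map (d T) (ws ++ longNodes T)) ≤ e T
  sum-longNodes {T} ws ws! short = sum-⊆ (Unique.++⁺ ws! (Unique.filter⁺ long? (M-! T)) disjoint) (M T)
    λ w∈ → ⊆M w∈ , ≤-refl
    where
    disjoint : ∀ {w} → ¬ (w ∈ ws × w ∈ longNodes T)
    disjoint (w∈ , w∈′) = <⇒≱ (proj₁ (All.lookup short w∈)) (proj₂ (∈-filter⁻ long? {xs = M T} w∈′))
    ⊆M : ∀ {w} → w ∈ ws ++ longNodes T → w ∈ M T
    ⊆M w∈ with ∈-++⁻ ws w∈
    ... | inj₁ w∈ws = proj₂ (All.lookup short w∈ws)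
    ... | inj₂ w∈′  = proj₁ (∈-filter⁻ long? {xs = M T} w∈′)

  -- The effect of prepending one character.

  longestRepeatedPrefix : ∀ T a → ∃₂ λ x c → IsPrefix (x ∷ʳ c) (a ∷ T) × IsSubstr x T × ¬ IsSubstr (x ∷ʳ c) T
  longestRepeatedPrefix T a = go [] (a ∷ T) refl ([] , T , refl)
    where
    go : ∀ p q → a ∷ T ≡ p ++ q → IsSubstr p T →
      ∃₂ λ x c → IsPrefix (x ∷ʳ c) (a ∷ T) × IsSubstr x T × ¬ IsSubstr (x ∷ʳ c) T
    -- The scan cannot reach the end: `p` would be all of `a ∷ T`, which is longer than `T`.
    go p []      eq p⊑T = contradiction (substr-length (subst (λ v → IsSubstr v T) (trans (sym (++-identityʳ p)) (sym eq)) p⊑T)) (<⇒≱ ≤-refl)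
    go p (c ∷ q) eq p⊑T with substr-dec (p ∷ʳ c) T | trans eq (sym (++-assoc p [ c ] q))
    ... | yes pc⊑T | eq′ = go (p ∷ʳ c) q eq′ pc⊑T
    ... | no ¬pc⊑T | eq′ = p , c , (q , eq′) , p⊑T , ¬pc⊑T

  module Extension (T : List A) (a : A) (x₀ : List A) (c₀ : A)
    (x₀c₀-prefix : IsPrefix (x₀ ∷ʳ c₀) (a ∷ T)) (x₀⊑T : IsSubstr x₀ T) (x₀c₀⋢T : ¬ IsSubstr (x₀ ∷ʳ c₀) T) where

    aT : List A
    aT = a ∷ T

    rest : List A
    rest = proj₁ x₀c₀-prefix

    aT≡ : aT ≡ x₀ ++ c₀ ∷ rest
    aT≡ = trans (proj₂ x₀c₀-prefix) (++-assoc x₀ [ c₀ ] rest)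

    -- A prefix of `aT` longer than `x₀` begins with `x₀ ∷ʳ c₀`, which does not occur in `T`.
    repeated-prefix : ∀ {w} → IsPrefix w aT → IsSubstr w T → ∃ λ s → x₀ ≡ w ++ s
    repeated-prefix {w} (q , eq) w⊑T with compare-prefixes w x₀ (trans (sym eq) aT≡)
    ... | inj₁ x₀≡ = x₀≡
    ... | inj₂ (e , s , refl , c₀∷≡) with refl ← proj₁ (∷-injective c₀∷≡) =
      contradiction (substr-prefix (x₀ ∷ʳ c₀) (subst (λ v → IsSubstr v T) (sym (++-assoc x₀ [ c₀ ] s)) w⊑T)) x₀c₀⋢T

    -- A new substring is a prefix of `aT`, so `w` is a prefix of `x₀`. Were it a proper one,
    -- `w ∷ʳ c` would be a prefix of `x₀` and occur in `T`.
    new-extension : ∀ {w c} → IsSubstr w T → IsSubstr (w ∷ʳ c) aT → ¬ IsSubstr (w ∷ʳ c) T → w ≡ x₀ × c ≡ c₀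
    new-extension {w} {c} w⊑T wc⊑aT wc⋢T with substr-∷ wc⊑aT
    ... | inj₂ wc⊑T = contradiction wc⊑T wc⋢T
    ... | inj₁ (q , eq) with trans eq (++-assoc w [ c ] q)
    ...   | eq′ with repeated-prefix (c ∷ q , eq′) w⊑T
    ...     | [] , x₀≡w++[] with trans x₀≡w++[] (++-identityʳ w)
    ...       | refl = refl , proj₁ (∷-injective (++-cancelˡ w _ _ (trans (sym eq′) aT≡)))
    new-extension {w} {c} w⊑T wc⊑aT wc⋢T | inj₁ (q , eq) | eq′ | e ∷ s , refl
      with refl ← proj₁ (∷-injective (++-cancelˡ w _ _ (trans (sym eq′) (trans aT≡ (++-assoc w (e ∷ s) _))))) =
      contradiction (substr-prefix (w ∷ʳ c) (subst (λ v → IsSubstr v T) (sym (++-assoc w [ c ] s)) x₀⊑T)) wc⋢T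

    -- If `w` does not occur in `T`, it occurs in `aT` only at the start. It then has at most one
    -- right extension, so it is right-maximal only as a suffix, that is, as `aT`.
    node-⊑ : ∀ {w} → w ∈ M aT → IsSubstr w T ⊎ w ≡ aT
    node-⊑ {w} w∈ with substr-dec w T
    ... | yes w⊑T = inj₁ w⊑T
    ... | no w⋢T with proj₂ (∈-M⁻ {aT} w∈)
    ...   | inj₁ ([] , eq)    = inj₂ (sym eq)
    ...   | inj₁ (b ∷ p , eq) = contradiction
              (p , [] , trans (proj₂ (∷-injective eq)) (cong (p ++_) (sym (++-identityʳ w)))) w⋢T
    ...   | inj₂ (c , c′ , c≢c′ , wc , wc′) with substr-∷ wc | substr-∷ wc′
    ...     | inj₂ wc⊑T | _          = contradiction (substr-prefix w wc⊑T) w⋢T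
    ...     | inj₁ _    | inj₂ wc′⊑T = contradiction (substr-prefix w wc′⊑T) w⋢T
    ...     | inj₁ (q , eq) | inj₁ (q′ , eq′) = contradiction
              (proj₁ (∷-injective (++-cancelˡ w _ _
                (trans (sym (++-assoc w [ c ] q)) (trans (sym eq) (trans eq′ (++-assoc w [ c′ ] q′)))))))
              c≢c′

    aT-inextensible : ∀ {c} → ¬ IsSubstr (aT ∷ʳ c) aT
    aT-inextensible {c} sub = <⇒≱ (≤-reflexive (trans (+-comm 1 _) (sym (length-++ aT)))) (substr-length sub)

    d-other : ∀ {w} → w ∈ M aT → w ≢ x₀ → d aT w ≤ d T w
    d-other {w} w∈ w≢x₀ = d-≤ {w = w} into
      where
      into : ∀ {c} → IsSubstr (w ∷ʳ c) aT → c ∈ rightExts T w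
      into {c} wc⊑aT with substr-dec (w ∷ʳ c) T | node-⊑ w∈
      ... | yes wc⊑T | _        = ∈-rightExts⁺ wc⊑T
      ... | no wc⋢T | inj₁ w⊑T  = contradiction (proj₁ (new-extension w⊑T wc⊑aT wc⋢T)) w≢x₀
      ... | no wc⋢T | inj₂ refl = contradiction wc⊑aT aT-inextensible

    d-x₀ : d aT x₀ ≤ suc (d T x₀)
    d-x₀ = d-≤ {w = x₀} {c₀ ∷ rightExts T x₀} into
      where
      into : ∀ {c} → IsSubstr (x₀ ∷ʳ c) aT → c ∈ c₀ ∷ rightExts T x₀
      into {c} x₀c⊑aT with substr-dec (x₀ ∷ʳ c) T
      ... | yes x₀c⊑T = there (∈-rightExts⁺ x₀c⊑T)
      ... | no x₀c⋢T  = here (proj₂ (new-extension x₀⊑T x₀c⊑aT x₀c⋢T))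

    -- Two left extensions in `aT` cannot be the cause: if one of them is not in `T`, it is a prefix
    -- of `aT`, so `w` is a prefix of `T` and already left-maximal.
    new-leftMaximal : ∀ {w} → LeftMaximal aT w → ¬ LeftMaximal T w → IsPrefix w aT
    new-leftMaximal (inj₁ pre) ¬lm = pre
    new-leftMaximal (inj₂ (c , c′ , c≢c′ , cw , c′w)) ¬lm with substr-∷ cw | substr-∷ c′w
    ... | inj₂ cw⊑T     | inj₂ c′w⊑T    = contradiction (inj₂ (c , c′ , c≢c′ , cw⊑T , c′w⊑T)) ¬lm
    ... | inj₁ (q , eq) | _             = contradiction (inj₁ (q , proj₂ (∷-injective eq))) ¬lm
    ... | inj₂ _        | inj₁ (q , eq) = contradiction (inj₁ (q , proj₂ (∷-injective eq))) ¬lm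

    -- A suffix of `aT` that occurs in `T` is a suffix of `T`, so only a new right extension can be
    -- the cause, and the only one belongs to `x₀`.
    new-rightMaximal : ∀ {w} → RightMaximal aT w → IsSubstr w T → ¬ RightMaximal T w → w ≡ x₀
    new-rightMaximal (inj₁ ([] , refl)) w⊑T ¬rm = contradiction (substr-length w⊑T) (<⇒≱ ≤-refl)
    new-rightMaximal (inj₁ (b ∷ p , eq)) w⊑T ¬rm = contradiction (inj₁ (p , proj₂ (∷-injective eq))) ¬rm
    new-rightMaximal {w} (inj₂ (c , c′ , c≢c′ , wc , wc′)) w⊑T ¬rm with substr-dec (w ∷ʳ c) T | substr-dec (w ∷ʳ c′) T
    ... | yes wc⊑T | yes wc′⊑T = contradiction (inj₂ (c , c′ , c≢c′ , wc⊑T , wc′⊑T)) ¬rm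
    ... | no wc⋢T  | _         = proj₁ (new-extension w⊑T wc wc⋢T)
    ... | yes _    | no wc′⋢T  = proj₁ (new-extension w⊑T wc′ wc′⋢T)

    -- Fresh nodes and the charging of edges.

    Fresh : List A → Set
    Fresh w = IsSubstr w T × RightMaximal T w × ¬ LeftMaximal T w

    fresh? : ∀ w → Dec (Fresh w)
    fresh? w = substr-dec w T ×-dec (rightMaximal-dec T w ×-dec ¬? (leftMaximal-dec T w))

    -- Where the edges of a node of M (aT) are charged: to the node itself, to the
    -- left closure of a fresh node, or to one of the two nodes x₀ and aT.
    data Charge : Set where
      old closure : List A → Charge
      at-x₀ at-aT : Charge

    -- The relation passed to `sum-match`; its `closure` case carries the data that
    -- `forced-injective` asks for.
    Charged : List A → Charge → Set
    Charged w (old y)     = w ≡ y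
    Charged w (closure y) = IsPrefix w aT × IsSubstr w T × ∃ λ α → Forced T α w × y ≡ α ++ w
    Charged w at-x₀       = w ≡ x₀
    Charged w at-aT       = w ≡ aT

    charged-injective : ∀ {w w′} y → Charged w y → Charged w′ y → w ≡ w′
    charged-injective (old y) refl refl = refl
    charged-injective (closure y) (pre , sub , α , forced , y≡) (pre′ , sub′ , α′ , forced′ , y≡′) =
      forced-injective {α = α} {α′} pre pre′ sub sub′ forced forced′ y≡ y≡′
    charged-injective at-x₀ refl refl = refl
    charged-injective at-aT refl refl = refl

    -- `L` receives the closures of fresh nodes, and `k` pays for `x₀` if it is not right-maximal in
    -- `T`. The leading `suc` is the new edge from `x₀` by `c₀`.
    e-aT-≤ : ∀ L k →
      (∀ {w} → w ∈ M aT → Fresh w → ∃ λ α → α ++ w ∈ L × Forced T α w × d T w ≤ d T (α ++ w)) →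
      (¬ RightMaximal T x₀ → 1 ≤ k) →
      e aT ≤ suc (e T + (sum (map (d T) L) + k))
    e-aT-≤ L k close 1≤k = begin
      e aT                                    ≤⟨ sum-except-one _≟ₛ_ x₀ d-x₀ (M-! aT) d-other ⟩
      suc (sum (map (d T) (M aT)))            ≤⟨ s≤s (sum-match {g = weight} Charged (λ {_} {_} {y} → charged-injective y) (M-! aT) charges charge) ⟩
      suc (sum (map weight charges))          ≡⟨ cong suc (sum-charges (M T)) ⟩
      suc (e T + (sum (map (d T) L) + k))     ∎
      where
      open ≤-Reasoning
      weight : Charge → ℕ
      weight (old y)     = d T y
      weight (closure y) = d T y
      weight at-x₀       = k
      -- Degrees are now counted in `T`, where `aT` does not occur.
      weight at-aT       = 0

      charges : List Charge
      charges = map old (M T) ++ map closure L ++ at-x₀ ∷ at-aT ∷ []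

      sum-charges : ∀ N → sum (map weight (map old N ++ map closure L ++ at-x₀ ∷ at-aT ∷ [])) ≡
        sum (map (d T) N) + (sum (map (d T) L) + k)
      sum-charges N
        rewrite map-++ weight (map old N) (map closure L ++ at-x₀ ∷ at-aT ∷ [])
              | map-++ weight (map closure L) (at-x₀ ∷ at-aT ∷ [])
              | sum-++ (map weight (map old N)) (map weight (map closure L) ++ k ∷ 0 ∷ [])
              | sum-++ (map weight (map closure L)) (k ∷ 0 ∷ [])
              | sym (map-∘ {g = weight} {f = old} N)
              | sym (map-∘ {g = weight} {f = closure} L)
              | +-identityʳ k = refl

      charge : ∀ {w} → w ∈ M aT → ∃ λ y → y ∈ charges × Charged w y × d T w ≤ weight y
      charge {w} w∈ with node-⊑ w∈ | ∈-M⁻ {aT} w∈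
      ... | inj₂ refl | _ = at-aT , ∈-++⁺ʳ (map old (M T)) (∈-++⁺ʳ (map closure L) (there (here refl))) , refl
                          , d-≤ {T} {aT} {[]} λ aTc⊑T → contradiction (substr-length (substr-prefix aT aTc⊑T)) (<⇒≱ ≤-refl)
      ... | inj₁ w⊑T | lm′ , rm′ with rightMaximal-dec T w | leftMaximal-dec T w
      ...   | yes rm | yes lm = old w , ∈-++⁺ˡ (∈-map⁺ old (∈-M⁺ lm rm)) , refl , ≤-refl
      ...   | yes rm | no ¬lm =
        let α , αw∈L , forced , d≤ = close w∈ (w⊑T , rm , ¬lm)
        in closure (α ++ w) , ∈-++⁺ʳ (map old (M T)) (∈-++⁺ˡ (∈-map⁺ closure αw∈L))
         , (new-leftMaximal lm′ ¬lm , w⊑T , α , forced , refl) , d≤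
      ...   | no ¬rm | _ with refl ← new-rightMaximal rm′ w⊑T ¬rm =
        at-x₀ , ∈-++⁺ʳ (map old (M T)) (∈-++⁺ʳ (map closure L) (here refl)) , refl
        , ≤-trans d≤1 (1≤k ¬rm)
        where
        d≤1 : d T x₀ ≤ 1
        d≤1 with 2 ≤? d T x₀
        ... | no 2≰d  = ≤-pred (≰⇒> 2≰d)
        ... | yes 2≤d = let c , c′ , c≢c′ , c∈ , c′∈ = two-elements (rightExts-! T x₀) 2≤d
                        in contradiction (inj₂ (c , c′ , c≢c′ , ∈-rightExts⁻ {w = x₀} c∈ , ∈-rightExts⁻ {w = x₀} c′∈)) ¬rm

    -- Paying with the nodes of length at most 1.

    fresh-closure : ∀ {w} → Fresh w → ∃ λ α → α ++ w ∈ longNodes T × Forced T α w × d T w ≤ d T (α ++ w)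
    fresh-closure {w} (w⊑T , rm , ¬lm) with leftClosure w⊑T
    ... | α , forced , lm = α , ∈-filter⁺ long? (∈-M⁺ {T} lm (forced-rightMaximal w forced rm)) (long α w ¬lm lm) , forced
                          , d-≤ {w = w} λ {c} wc⊑T → ∈-rightExts⁺ {w = α ++ w}
                              (subst (λ v → IsSubstr v T) (sym (++-assoc α w [ c ])) (forced-substr w forced wc⊑T))
      where
      -- Since the empty string is left-maximal, `w` is nonempty; since `α ++ w` is left-maximal and
      -- `w` is not, so is `α`.
      long : ∀ α w → ¬ LeftMaximal T w → LeftMaximal T (α ++ w) → 2 ≤ length (α ++ w)
      long []      w       ¬lm lm = contradiction lm ¬lm
      long (c ∷ α) []      ¬lm lm = contradiction ε-leftMaximal ¬lm
      long (c ∷ α) (b ∷ w) ¬lm lm = s≤s (≤-trans (s≤s z≤n) (length-++-≤ʳ (b ∷ w) {α}))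

    ε∈M : [] ∈ M T
    ε∈M = ∈-M⁺ {T} ε-leftMaximal ε-rightMaximal

    d-ε-bound : ∀ {k} → k ≤ d T [] → k + sum (map (d T) (longNodes T)) ≤ e T
    d-ε-bound {k} k≤d = ≤-trans (+-monoˡ-≤ _ k≤d) (sum-longNodes {T} ([] ∷ []) ([] ∷ []) ((s≤s z≤n , ε∈M) ∷ []))

    -- Two distinct extensions of z: either the node z is saved as well, or zz does
    -- not occur, so z differs from both extensions and ε has degree at least 3.
    branching-character : ∀ {z c c′} → c ≢ c′ → IsSubstr (z ∷ c ∷ []) T → IsSubstr (z ∷ c′ ∷ []) T →
      3 + sum (map (d T) (longNodes T)) ≤ e T
    branching-character {z} {c} {c′} c≢c′ zc zc′ with leftMaximal-dec T [ z ]
    ... | yes lm = begin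
      3 + sum (map (d T) (longNodes T))                      ≤⟨ +-monoˡ-≤ _ (+-mono-≤ 1≤d 2≤d) ⟩
      d T [] + d T [ z ] + sum (map (d T) (longNodes T))     ≡⟨ +-assoc (d T []) (d T [ z ]) _ ⟩
      d T [] + (d T [ z ] + sum (map (d T) (longNodes T)))   ≤⟨ sum-longNodes {T} ([] ∷ [ z ] ∷ []) (unique-pair λ ())
        ((s≤s z≤n , ε∈M) ∷ (s≤s (s≤s z≤n) , ∈-M⁺ lm (inj₂ (c , c′ , c≢c′ , zc , zc′))) ∷ []) ⟩
      e T                                                    ∎
      where
      open ≤-Reasoning
      1≤d : 1 ≤ d T []
      1≤d = d-≥ {w = []} ([] ∷ []) (substr-prefix [ z ] zc ∷ [])
      2≤d : 2 ≤ d T [ z ]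
      2≤d = d-≥ {w = [ z ]} (unique-pair c≢c′) (zc ∷ zc′ ∷ [])
    ... | no ¬lm = d-ε-bound (d-≥ {w = []} ((≢z zc ∷ ≢z zc′ ∷ []) ∷ unique-pair c≢c′)
                     (substr-prefix [ z ] zc ∷ substr-suffix [ z ] zc ∷ substr-suffix [ z ] zc′ ∷ []))
      where
      ≢z : ∀ {c} → IsSubstr (z ∷ c ∷ []) T → z ≢ c
      ≢z zc refl = ¬lm (square⇒leftMaximal zc)

    -- `w` is right-maximal and `x₀` is not, so `w` is a proper prefix of `x₀`. An occurrence of
    -- `x₀` in `T` is not at the end, so some `c` follows it, different from `c₀`; the last
    -- character `z` of `x₀` then branches.
    x₀-not-rightMaximal : ∀ {w} → w ∈ M aT → Fresh w → ¬ RightMaximal T x₀ →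
      3 + sum (map (d T) (longNodes T)) ≤ e T
    x₀-not-rightMaximal {[]}    w∈ (_ , _ , ¬lm) ¬rm = contradiction ε-leftMaximal ¬lm
    x₀-not-rightMaximal {b ∷ w} w∈ (w⊑T , rm , ¬lm) ¬rm
      with s , x₀≡ ← repeated-prefix (new-leftMaximal (proj₁ (∈-M⁻ {aT} w∈)) ¬lm) w⊑T
      with initLast s | proj₁ (proj₂ x₀⊑T) | proj₂ (proj₂ x₀⊑T)
    ... | [] | _ | _ = contradiction (subst (RightMaximal T) (sym (trans x₀≡ (++-identityʳ (b ∷ w)))) rm) ¬rm
    ... | s′ ∷ʳ′ z | [] | eq = contradiction (inj₁ (proj₁ x₀⊑T , trans eq (cong (proj₁ x₀⊑T ++_) (++-identityʳ x₀)))) ¬rm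
    ... | s′ ∷ʳ′ z | c ∷ q | eq = branching-character c≢c₀ zc zc₀
      where
      x₀c⊑T : IsSubstr (x₀ ∷ʳ c) T
      x₀c⊑T = proj₁ x₀⊑T , q , trans eq (cong (proj₁ x₀⊑T ++_) (sym (++-assoc x₀ [ c ] q)))
      c≢c₀ : c ≢ c₀
      c≢c₀ refl = x₀c₀⋢T x₀c⊑T
      x₀≡′ : x₀ ≡ (b ∷ w ++ s′) ∷ʳ z
      x₀≡′ = trans x₀≡ (sym (++-assoc (b ∷ w) s′ [ z ]))
      zc : IsSubstr (z ∷ c ∷ []) T
      zc = substr-suffix (b ∷ w ++ s′) (subst (λ v → IsSubstr v T)
             (trans (cong (_∷ʳ c) x₀≡′) (++-assoc (b ∷ w ++ s′) [ z ] [ c ])) x₀c⊑T)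
      -- At the start of `aT` the nonempty `b ∷ w` stands before `z`, so `z` and `c₀` survive the
      -- removal of the first character.
      zc₀ : IsSubstr (z ∷ c₀ ∷ []) T
      zc₀ = w ++ s′ , rest , proj₂ (∷-injective
              (trans aT≡ (trans (cong (_++ c₀ ∷ rest) x₀≡′) (++-assoc (b ∷ w ++ s′) [ z ] (c₀ ∷ rest)))))

    -- When a fresh node exists, `e-aT-≤` adds 1 for `c₀` and `k` for `x₀`, and strictness takes one
    -- more. The short nodes must save 2 if `x₀` is right-maximal in `T`, and 3 if not.
    doubling : 3 ≤ e T → e aT < e T + e T
    doubling 3≤e with any? fresh? (M aT)
    -- With `L` empty the surplus is at most 2, which `3 ≤ e T` exceeds.
    ... | no ¬fresh = begin-strict
      e aT             ≤⟨ e-aT-≤ [] 1 (λ w∈ fresh → contradiction (lose w∈ fresh) ¬fresh) (λ _ → ≤-refl) ⟩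
      suc (e T + 1)    ≡⟨ +-suc (e T) 1 ⟨
      e T + 2          <⟨ +-monoʳ-< (e T) 3≤e ⟩
      e T + e T        ∎
      where open ≤-Reasoning
    ... | yes any with w , w∈ , fresh ← find any with rightMaximal-dec T x₀
    ...   | yes rm = begin-strict
      e aT                ≤⟨ e-aT-≤ (longNodes T) 0 (λ _ → fresh-closure) (contradiction rm) ⟩
      suc (e T + (S + 0)) ≡⟨ cong (λ n → suc (e T + n)) (+-identityʳ S) ⟩
      suc (e T + S)       ≡⟨ +-suc (e T) S ⟨
      e T + suc S         <⟨ +-monoʳ-< (e T) (d-ε-bound (¬leftMaximal⇒2≤d (proj₁ fresh) (proj₂ (proj₂ fresh)))) ⟩
      e T + e T           ∎
      where
      open ≤-Reasoning
      S = sum (map (d T) (longNodes T))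
    ...   | no ¬rm = begin-strict
      e aT                ≤⟨ e-aT-≤ (longNodes T) 1 (λ _ → fresh-closure) (λ _ → ≤-refl) ⟩
      suc (e T + (S + 1)) ≡⟨ cong (λ n → suc (e T + n)) (+-comm S 1) ⟩
      suc (e T + suc S)   ≡⟨ +-suc (e T) (suc S) ⟨
      e T + suc (suc S)   <⟨ +-monoʳ-< (e T) (x₀-not-rightMaximal w∈ fresh ¬rm) ⟩
      e T + e T           ∎
      where
      open ≤-Reasoning
      S = sum (map (d T) (longNodes T))

-- The bound over the integers.

difference-≤ : ∀ m n → m < n + n → (+ m - + n) ℤ.≤ (+ n - + 1)
difference-≤ m zero ()
difference-≤ m n@(suc n′) m<n+n = begin
  -- For `n = suc n′` the strict bound reads `m ≤ n + n′`, and `+ n - + 1` computes to `+ n′`.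
  + m - + n          ≤⟨ ℤ.+-monoˡ-≤ (ℤ.- (+ n)) (ℤ.+≤+ (≤-pred (subst (m <_) (+-suc n n′) m<n+n))) ⟩
  + (n + n′) - + n   ≡⟨ ℤ.m-n≡m⊖n (n + n′) n ⟩
  (n + n′) ℤ.⊖ n     ≡⟨ cong ((n + n′) ℤ.⊖_) (+-identityʳ n) ⟨
  (n + n′) ℤ.⊖ (n + 0) ≡⟨ ℤ.+-cancelˡ-⊖ n n′ 0 ⟩
  + n′               ∎
  where open ℤ.≤-Reasoning

theorem1 : {A : Set} (_≟_ : DecidableEquality A) (T : List A) (a : A) →
    3 ≤ length T → 3 ≤ CDAWG.e _≟_ T →
    Data.Integer._≤_ (+ CDAWG.e _≟_ (a ∷ T) - + CDAWG.e _≟_ T) (+ CDAWG.e _≟_ T - + 1)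
theorem1 _≟_ T a _ 3≤e with x₀ , c₀ , x₀c₀-prefix , x₀⊑T , x₀c₀⋢T ← longestRepeatedPrefix _≟_ T a =
  difference-≤ (CDAWG.e _≟_ (a ∷ T)) (CDAWG.e _≟_ T) (Extension.doubling _≟_ T a x₀ c₀ x₀c₀-prefix x₀⊑T x₀c₀⋢T 3≤e)
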